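{- Let $k$ be a positive integer, let $H$ be a $k$-connected graph, and let $W$ be a possibly empty subset of $V(H)$. Set $w=|W|$. Suppose that $E(H-W)\neq\emptyset$. If $d_H(x)\ge h(k,w)$ for every $x\in V(H)\setminus W$, where \[ h(k,w):=\max\Bigl\{\,k+\Bigl\lceil\tfrac{w+1}{4}\Bigr\rceil,\ \min\Bigl\{k+\Bigl\lceil\tfrac{w+1}{2}\Bigr\rceil,\ w+2\Bigr\}\Bigr\}, \] then $H$ has a $k$-removable edge with both ends in $V(H)\setminus W$.
   Context: All graphs are finite, undirected and simple. $d_H(x)$ denotes the degree of $x$ in $H$, and $H-W$ is the graph obtained from $H$ by deleting the vertices in $W$ and all incident edges. A graph is $k$-connected if it has at least $k+1$ vertices and deleting any set of at most $k-1$ vertices leaves a connected graph. An edge $e$ of a $k$-connected graph $H$ is $k$-removable if the graph $H-e$, obtained by deleting the edge $e$ (keeping all vertices), is $k$-connected. -}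

module Defs where

open import Data.Fin using (Fin; _≟_)
open import Data.Fin.Subset using (Subset; _∈_; ∁; ∣_∣)
open import Data.Nat using (ℕ; _+_; _∸_; _<_; _⊔_; _⊓_; _/_; NonZero)
open import Data.Product using (∃; _×_; _,_; proj₁; swap)
open import Data.Sum using (_⊎_)
import Data.Sum as Sum
open import Data.Vec using (tabulate)
open import Function using (_∘_; _on_)
open import Level using (0ℓ)
open import Relation.Binary using (Rel; Symmetric; Irreflexive; Decidable)
open import Relation.Binary.Construct.Closure.ReflexiveTransitive using (Star)
open import Relation.Binary.PropositionalEquality using (_≡_; refl)
open import Relation.Nullary using (¬_; does; ¬?; _×-dec_; _⊎-dec_)

-- Simple undirected graphs. Finiteness comes from the vertex type: it is
-- Fin n, or the members of a Subset n.
record Graph (V : Set) : Set₁ where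
  field
    Adj    : Rel V 0ℓ
    adj?   : Decidable Adj
    sym    : Symmetric Adj
    irrefl : Irreflexive _≡_ Adj

open Graph public using (Adj; adj?)

-- Each edge occurs here once per ordering of its two ends; the definitions
-- below do not depend on the ordering.
record Edge {V : Set} (G : Graph V) : Set where
  constructor edge
  field
    end₁ end₂ : V
    joined    : Adj G end₁ end₂

open Edge public

-- There is a walk between any two vertices. The graph with no vertices counts
-- as connected, but KConnected never applies this to fewer than two vertices.
Connected : {V : Set} → Graph V → Set
Connected G = ∀ u v → Star (Adj G) u v

neighbours : ∀ {n} → Graph (Fin n) → Fin n → Subset n
neighbours G x = tabulate (λ y → does (adj? G x y))

degree : ∀ {n} → Graph (Fin n) → Fin n → ℕ
degree G x = ∣ neighbours G x ∣

infixl 5 _─ᵛ_ _─ᵉ_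

-- Vertices are given by x ∈ ∁ W rather than x ∉ W because membership proofs
-- are unique: each remaining vertex is then represented exactly once.
_─ᵛ_ : ∀ {n} → Graph (Fin n) → (W : Subset n) → Graph (∃ λ x → x ∈ ∁ W)
G ─ᵛ W = record
  { Adj    = Adj G on proj₁
  ; adj?   = λ u v → adj? G (proj₁ u) (proj₁ v)
  ; sym    = Graph.sym G
  ; irrefl = λ { refl → Graph.irrefl G refl }
  }

Joins : ∀ {V} {G : Graph V} → Edge G → Rel V 0ℓ
Joins e u v = (u ≡ end₁ e × v ≡ end₂ e) ⊎ (u ≡ end₂ e × v ≡ end₁ e)

_─ᵉ_ : ∀ {n} (G : Graph (Fin n)) → Edge G → Graph (Fin n)
G ─ᵉ e = record
  { Adj    = λ u v → Adj G u v × ¬ Joins e u v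
  ; adj?   = λ u v → adj? G u v ×-dec
               ¬? ((u ≟ end₁ e ×-dec v ≟ end₂ e) ⊎-dec (u ≟ end₂ e ×-dec v ≟ end₁ e))
  ; sym    = λ (a , ne) → Graph.sym G a , ne ∘ Sum.swap ∘ Sum.map swap swap
  ; irrefl = λ { eq (a , _) → Graph.irrefl G eq a }
  }

KConnected : ∀ {n} → ℕ → Graph (Fin n) → Set
KConnected {n} k G = k < n × (∀ (S : Subset n) → ∣ S ∣ < k → Connected (G ─ᵛ S))

Removable : ∀ {n} → ℕ → (G : Graph (Fin n)) → Edge G → Set
Removable k G e = KConnected k (G ─ᵉ e)

⌈_/_⌉ : (m d : ℕ) .{{_ : NonZero d}} → ℕ
⌈ m / d ⌉ = (m + (d ∸ 1)) / d

h : ℕ → ℕ → ℕ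
h k w = (k + ⌈ w + 1 / 4 ⌉) ⊔ ((k + ⌈ w + 1 / 2 ⌉) ⊓ (w + 2))

{-# OPTIONS --safe #-}
-- If xy is not removable, then fewer than k vertices (the cut) separate x from
-- y in H − xy, and xy is the only edge between the near side, containing x,
-- and the far side, containing y. Let xz be another edge, separated likewise.
-- As x has degree above k, the cut around the corner near ∩ near has at least
-- k − 1 vertices, so by submodularity the one around far ∩ far has fewer than
-- k: that corner is empty, and counting shows that the far side for xz is
-- smaller than the near side for xy. If vertices outside W have degree at
-- least |W| + 2, then x always has a second neighbour z outside W, and the
-- descent never ends unless a removable edge is met. If they have degree at
-- least k + ⌈(|W| + 1)/2⌉, descend among near sides with fewer than
-- ⌈(|W| + 1)/2⌉ vertices of W. Then x has a neighbour z outside W on its own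
-- side, and one of the two sides for xz contains few vertices of W. If only
-- the side of x does, it is smaller than the near side for xy, unless the
-- corner around z is itself the near side of a separation for zx.
module Submission where

open import Defs
open import Data.Bool using (Bool; true; false; _∧_; _∨_; if_then_else_)
open import Data.Empty using (⊥)
open import Data.Fin using (Fin; zero; suc; _≟_)
open import Data.Fin.Properties using (any?)
open import Data.Fin.Subset using (Subset; _∈_; _∉_; ∁; _∪_; _⊃_; ⁅_⁆; ∣_∣)
open import Data.Fin.Subset.Induction using (⊃-wellFounded; Acc; acc)
open import Data.Fin.Subset.Properties
  using (_∈?_; x∈⁅x⁆; x∈⁅y⁆⇒x≡y; ∣⁅x⁆∣≡1; x∈∁p⇒x∉p; x∉p⇒x∈∁p; p⊆p∪q; q⊆p∪q; x∈p∪q⁻)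
open import Data.Nat using (ℕ; zero; suc; _+_; _*_; _%_; _≤_; _<_; _⊓_; z≤n; s≤s; _≤?_; _<?_)
open import Data.Nat.DivMod using (/-monoˡ-≤; m≡m%n+[m/n]*n; m%n<n)
open import Data.Nat.Induction using (<-wellFounded)
open import Data.Nat.Properties hiding (_≟_; _≤?_; _<?_)
open import Data.Product using (∃; _×_; _,_; proj₁; proj₂)
open import Data.Sum using (_⊎_; inj₁; inj₂)
open import Data.Vec using ([]; _∷_; lookup; tabulate)
open import Data.Vec.Properties using ([]=⇒lookup; lookup⇒[]=; lookup∘tabulate; tabulate∘lookup)
open import Data.Vec.Properties.WithK using ([]=-irrelevant)
open import Function using (_∘_; case_of_)
open import Relation.Binary.Construct.Closure.ReflexiveTransitive using (Star; ε; _◅_; _◅◅_)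
open import Relation.Binary.PropositionalEquality
  using (_≡_; _≢_; refl; sym; trans; cong; cong₂; subst; subst₂)
open import Relation.Nullary
  using (Dec; yes; no; does; contradiction; ¬?; _×-dec_; _⊎-dec_; decidable-stable)

private
  variable
    n k : ℕ

-- Counting vertices with Boolean predicates

ι : Bool → ℕ
ι false = 0
ι true  = 1

-- Counting through `tabulate` makes `degree H x` definitionally a count, so neighbourhoods compare
-- pointwise with other predicates.
# : (Fin n → Bool) → ℕ
# f = ∣ tabulate f ∣

#-suc : (f : Fin (suc n) → Bool) → # f ≡ ι (f zero) + # (f ∘ suc)
#-suc f with f zero
... | true  = refl
... | false = refl

#+#-suc : (f g : Fin (suc n) → Bool) →
          # f + # g ≡ (ι (f zero) + ι (g zero)) + (# (f ∘ suc) + # (g ∘ suc))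
#+#-suc f g = trans (cong₂ _+_ (#-suc f) (#-suc g))
  (interchange (ι (f zero)) (# (f ∘ suc)) (ι (g zero)) (# (g ∘ suc)))
  where
  open import Algebra.Properties.CommutativeSemigroup +-commutativeSemigroup using (interchange)

-- Reduces cardinality inequalities on sides and cuts to a case check at one vertex. Shorter sums
-- are padded with `none`.
#+#-mono-≤ : (f g p q : Fin n → Bool) →
             (∀ i → ι (f i) + ι (g i) ≤ ι (p i) + ι (q i)) → # f + # g ≤ # p + # q
#+#-mono-≤ {zero}  f g p q le = z≤n
#+#-mono-≤ {suc n} f g p q le = subst₂ _≤_ (sym (#+#-suc f g)) (sym (#+#-suc p q))
  (+-mono-≤ (le zero) (#+#-mono-≤ (f ∘ suc) (g ∘ suc) (p ∘ suc) (q ∘ suc) (le ∘ suc)))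

#+#-mono-< : (f g p q : Fin n → Bool) →
             (∀ i → ι (f i) + ι (g i) ≤ ι (p i) + ι (q i)) →
             ∀ j → ι (f j) + ι (g j) < ι (p j) + ι (q j) → # f + # g < # p + # q
#+#-mono-< f g p q le zero lt = subst₂ _<_ (sym (#+#-suc f g)) (sym (#+#-suc p q))
  (+-mono-<-≤ lt (#+#-mono-≤ (f ∘ suc) (g ∘ suc) (p ∘ suc) (q ∘ suc) (le ∘ suc)))
#+#-mono-< f g p q le (suc j) lt = subst₂ _<_ (sym (#+#-suc f g)) (sym (#+#-suc p q))
  (+-mono-≤-< (le zero) (#+#-mono-< (f ∘ suc) (g ∘ suc) (p ∘ suc) (q ∘ suc) (le ∘ suc) j lt))

none : (n : ℕ) → Fin n → Bool
none _ _ = false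

#-none : ∀ n → # (none n) ≡ 0
#-none zero    = refl
#-none (suc n) = #-none n

#-mono-≤ : (f g : Fin n → Bool) → (∀ i → f i ≡ true → g i ≡ true) → # f ≤ # g
#-mono-≤ {n} f g f⊆g =
  +-cancelʳ-≤ (# (none n)) (# f) (# g) (#+#-mono-≤ f (none n) g (none n) pointwise)
  where
  pointwise : ∀ i → ι (f i) + 0 ≤ ι (g i) + 0
  pointwise i with f i | f⊆g i
  ... | false | _  = z≤n
  ... | true  | gi rewrite gi refl = ≤-refl

#-∨ : (f g : Fin n → Bool) → # (λ i → f i ∨ g i) ≤ # f + # g
#-∨ {n} f g =
  ≤-trans (m≤m+n _ (# (none n))) (#+#-mono-≤ (λ i → f i ∨ g i) (none n) f g pointwise)
  where
  pointwise : ∀ i → ι (f i ∨ g i) + 0 ≤ ι (f i) + ι (g i)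
  pointwise i with f i | g i
  ... | true  | true  = s≤s z≤n
  ... | true  | false = ≤-refl
  ... | false | true  = ≤-refl
  ... | false | false = z≤n

#-lookup : (p : Subset n) → # (lookup p) ≡ ∣ p ∣
#-lookup p = cong ∣_∣ (tabulate∘lookup p)

only : Fin n → Fin n → Bool
only u = lookup ⁅ u ⁆

#-only : (u : Fin n) → # (only u) ≡ 1
#-only u = trans (#-lookup ⁅ u ⁆) (∣⁅x⁆∣≡1 u)

only-refl : (u : Fin n) → only u u ≡ true
only-refl u = []=⇒lookup (x∈⁅x⁆ u)

only-true : {u i : Fin n} → only u i ≡ true → i ≡ u
only-true {u = u} {i} eq = x∈⁅y⁆⇒x≡y u (lookup⇒[]= i ⁅ u ⁆ eq)

only-≢ : {u i : Fin n} → only u i ≡ false → i ≢ u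
only-≢ {u = u} eq refl = case trans (sym eq) (only-refl u) of λ ()

#-∨-only : (f : Fin n → Bool) (u : Fin n) → # (λ i → f i ∨ only u i) ≤ # f + 1
#-∨-only f u = ≤-trans (#-∨ f (only u)) (≤-reflexive (cong (# f +_) (#-only u)))

-- Pigeonhole: it later supplies a neighbour of `x` that avoids a prescribed smaller set.
#-< : (f g : Fin n → Bool) → # f < # g → ∃ λ i → g i ≡ true × f i ≡ false
#-< {suc n} f g lt with f zero in f0 | g zero in g0
... | false | true  = zero , g0 , f0
... | false | false = let i , p = #-< (f ∘ suc) (g ∘ suc) lt in suc i , p
... | true  | true  = let i , p = #-< (f ∘ suc) (g ∘ suc) (≤-pred lt) in suc i , p
... | true  | false = let i , p = #-< (f ∘ suc) (g ∘ suc) (<-trans ≤-refl lt) in suc i , p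

∨-introˡ : ∀ {a} b → a ≡ true → a ∨ b ≡ true
∨-introˡ b refl = refl

∨-introʳ : ∀ a {b} → b ≡ true → a ∨ b ≡ true
∨-introʳ true  _  = refl
∨-introʳ false eq = eq

∨-false : ∀ a {b} → a ∨ b ≡ false → a ≡ false × b ≡ false
∨-false false eq = refl , eq

-- Three-colourings and their corners

data Side : Set where
  near cut far : Side

isNear isCut : Side → Bool
isNear near = true
isNear _    = false
isCut cut = true
isCut _   = false

flip : Side → Side
flip near = far
flip cut  = cut
flip far  = near

-- The maximum for near < cut < far: the near side of a join of two separations
-- is the corner where both near sides meet, and its cut bounds that corner.
infixl 6 _⊔ˢ_
_⊔ˢ_ : Side → Side → Side
near ⊔ˢ t    = t
cut  ⊔ˢ far  = far
cut  ⊔ˢ _    = cut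
far  ⊔ˢ _    = far

⊔ˢ-near : ∀ s t → s ⊔ˢ t ≡ near → s ≡ near × t ≡ near
⊔ˢ-near near near eq = refl , refl
⊔ˢ-near cut near ()
⊔ˢ-near cut cut ()
⊔ˢ-near cut far ()

⊔ˢ-far : ∀ s t → s ⊔ˢ t ≡ far → s ≡ far ⊎ t ≡ far
⊔ˢ-far near far eq = inj₂ refl
⊔ˢ-far cut  far eq = inj₂ refl
⊔ˢ-far far  t   eq = inj₁ refl

⊔ˢ-farʳ : ∀ s {t} → t ≡ far → s ⊔ˢ t ≡ far
⊔ˢ-farʳ near refl = refl
⊔ˢ-farʳ cut  refl = refl
⊔ˢ-farʳ far  refl = refl

flip-near : ∀ s → flip s ≡ near → s ≡ far
flip-near far eq = refl

flip-far : ∀ s → flip s ≡ far → s ≡ near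
flip-far near eq = refl

isCut-true : ∀ s → isCut s ≡ true → s ≡ cut
isCut-true cut eq = refl

Colouring : ℕ → Set
Colouring n = Fin n → Side

#near #cut : Colouring n → ℕ
#near c = # (isNear ∘ c)
#cut  c = # (isCut ∘ c)

_⊔ᶜ_ : Colouring n → Colouring n → Colouring n
(c ⊔ᶜ d) i = c i ⊔ˢ d i

-- The joins have cuts around opposite corners. A vertex in both of these cuts lies in both given
-- cuts; a vertex in one of them lies in at least one given cut.
cut-submodular : (c d : Colouring n) →
  #cut (c ⊔ᶜ d) + #cut ((flip ∘ c) ⊔ᶜ (flip ∘ d)) ≤ #cut c + #cut d
cut-submodular c d = #+#-mono-≤ _ _ _ _ (λ i → pointwise (c i) (d i))
  where
  pointwise : ∀ s t → ι (isCut (s ⊔ˢ t)) + ι (isCut (flip s ⊔ˢ flip t)) ≤ ι (isCut s) + ι (isCut t)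
  pointwise near near = z≤n
  pointwise near cut  = ≤-refl
  pointwise near far  = z≤n
  pointwise cut  near = ≤-refl
  pointwise cut  cut  = ≤-refl
  pointwise cut  far  = ≤-refl
  pointwise far  near = z≤n
  pointwise far  cut  = ≤-refl
  pointwise far  far  = z≤n

cut-submodular′ : (c d : Colouring n) →
  #cut (c ⊔ᶜ (flip ∘ d)) + #cut ((flip ∘ c) ⊔ᶜ d) ≤ #cut c + #cut d
cut-submodular′ c d = #+#-mono-≤ _ _ _ _ (λ i → pointwise (c i) (d i))
  where
  pointwise : ∀ s t → ι (isCut (s ⊔ˢ flip t)) + ι (isCut (flip s ⊔ˢ t)) ≤ ι (isCut s) + ι (isCut t)
  pointwise near near = z≤n
  pointwise near cut  = ≤-refl
  pointwise near far  = z≤n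
  pointwise cut  near = ≤-refl
  pointwise cut  cut  = ≤-refl
  pointwise cut  far  = ≤-refl
  pointwise far  near = z≤n
  pointwise far  cut  = ≤-refl
  pointwise far  far  = z≤n

-- With far ∩ far empty, the far side of `d` and the cut around near ∩ near are disjoint sets inside
-- near ∪ cut of `c`. Strictness comes from `x`, which lies in neither.
far+join<near+cut : (c d : Colouring n) → (∀ i → c i ≡ far → d i ≢ far) →
  ∀ x → c x ≡ near → d x ≡ near → #near (flip ∘ d) + #cut (c ⊔ᶜ d) < #near c + #cut c
far+join<near+cut c d empty x cx dx =
  #+#-mono-< _ _ _ _ (λ i → pointwise (c i) (d i) (empty i)) x strict
  where
  pointwise : ∀ s t → (s ≡ far → t ≢ far) →
              ι (isNear (flip t)) + ι (isCut (s ⊔ˢ t)) ≤ ι (isNear s) + ι (isCut s)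
  pointwise near near e = z≤n
  pointwise near cut  e = ≤-refl
  pointwise near far  e = ≤-refl
  pointwise cut  near e = ≤-refl
  pointwise cut  cut  e = ≤-refl
  pointwise cut  far  e = ≤-refl
  pointwise far  near e = z≤n
  pointwise far  cut  e = z≤n
  pointwise far  far  e = contradiction refl (e refl)
  strict : ι (isNear (flip (d x))) + ι (isCut (c x ⊔ˢ d x)) < ι (isNear (c x)) + ι (isCut (c x))
  strict rewrite cx | dx = ≤-refl

-- With far ∩ near empty, the near side of `d` and the cut around near ∩ far are disjoint sets
-- inside near ∪ cut of `c`.
near+join≤near+cut : (c d : Colouring n) → (∀ i → c i ≡ far → d i ≢ near) →
  #near d + #cut (c ⊔ᶜ (flip ∘ d)) ≤ #near c + #cut c
near+join≤near+cut c d empty = #+#-mono-≤ _ _ _ _ (λ i → pointwise (c i) (d i) (empty i))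
  where
  pointwise : ∀ s t → (s ≡ far → t ≢ near) →
              ι (isNear t) + ι (isCut (s ⊔ˢ flip t)) ≤ ι (isNear s) + ι (isCut s)
  pointwise near near e = ≤-refl
  pointwise near cut  e = ≤-refl
  pointwise near far  e = z≤n
  pointwise cut  near e = ≤-refl
  pointwise cut  cut  e = ≤-refl
  pointwise cut  far  e = ≤-refl
  pointwise far  near e = contradiction refl (e refl)
  pointwise far  cut  e = z≤n
  pointwise far  far  e = z≤n

near-join-< : (c d : Colouring n) → ∀ x → c x ≡ near → d x ≡ far → #near (c ⊔ᶜ d) < #near c
near-join-< {n} c d x cx dx = +-cancelʳ-< (# (none n)) _ _
  (#+#-mono-< _ (none n) _ (none n) (λ i → pointwise (c i) (d i)) x strict)
  where
  pointwise : ∀ s t → ι (isNear (s ⊔ˢ t)) + 0 ≤ ι (isNear s) + 0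
  pointwise near near = ≤-refl
  pointwise near cut  = z≤n
  pointwise near far  = z≤n
  pointwise cut  near = z≤n
  pointwise cut  cut  = z≤n
  pointwise cut  far  = z≤n
  pointwise far  t    = z≤n
  strict : ι (isNear (c x ⊔ˢ d x)) + 0 < ι (isNear (c x)) + 0
  strict rewrite cx | dx = ≤-refl


nearW : Subset n → Colouring n → ℕ
nearW W c = # (λ i → isNear (c i) ∧ lookup W i)

nearW-flip : (W : Subset n) (c : Colouring n) → nearW W (flip ∘ c) + nearW W c ≤ ∣ W ∣
nearW-flip {n} W c = begin
  nearW W (flip ∘ c) + nearW W c
    ≤⟨ #+#-mono-≤ _ _ (lookup W) (none n) (λ i → pointwise (c i) (lookup W i)) ⟩
  # (lookup W) + # (none n)
    ≡⟨ cong₂ _+_ (#-lookup W) (#-none n) ⟩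
  ∣ W ∣ + 0
    ≡⟨ +-identityʳ _ ⟩
  ∣ W ∣ ∎
  where
  open ≤-Reasoning
  pointwise : ∀ s b → ι (isNear (flip s) ∧ b) + ι (isNear s ∧ b) ≤ ι b + 0
  pointwise near b = ≤-reflexive (+-comm 0 (ι b))
  pointwise cut  b = z≤n
  pointwise far  b = ≤-refl

-- Reachable sets and exhaustive search

does-true : ∀ {a} {A : Set a} (a? : Dec A) → does a? ≡ true → A
does-true (yes a) _ = a

∉-lookup : {S : Subset n} {i : Fin n} → lookup S i ≡ false → i ∉ S
∉-lookup eq i∈S = case trans (sym eq) ([]=⇒lookup i∈S) of λ ()

-- Grow a set of reachable vertices along edges that leave it. Strict growth among finitely many
-- vertices terminates, and the final set is closed.
reachable : (G : Graph (Fin n)) (S : Subset n) (u : ∃ (_∈ ∁ S)) → ∃ λ (X : Subset n) →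
  proj₁ u ∈ X ×
  (∀ a → a ∈ X → ∃ λ (a∈∁S : a ∈ ∁ S) → Star (Adj (G ─ᵛ S)) u (a , a∈∁S)) ×
  (∀ a b → a ∈ X → b ∉ S → Adj G a b → b ∈ X)
reachable {n} G S u =
  explore ⁅ proj₁ u ⁆ (⊃-wellFounded _) (x∈⁅x⁆ _)
    (λ a a∈ → case x∈⁅y⁆⇒x≡y _ a∈ of λ { refl → proj₂ u , ε })
  where
  Sound : Subset n → Set
  Sound X = ∀ a → a ∈ X → ∃ λ (a∈∁S : a ∈ ∁ S) → Star (Adj (G ─ᵛ S)) u (a , a∈∁S)

  explore : ∀ X → Acc _⊃_ X → proj₁ u ∈ X → Sound X → ∃ λ X → proj₁ u ∈ X × Sound X ×
            (∀ a b → a ∈ X → b ∉ S → Adj G a b → b ∈ X)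
  explore X (acc rs) u∈X sound
    with any? (λ a → any? (λ b → a ∈? X ×-dec ¬? (b ∈? S) ×-dec adj? G a b ×-dec ¬? (b ∈? X)))
  ... | no none-leaves = X , u∈X , sound , λ a b a∈X b∉S ab →
    decidable-stable (b ∈? X) (λ b∉X → none-leaves (a , b , a∈X , b∉S , ab , b∉X))
  ... | yes (a , b , a∈X , b∉S , ab , b∉X) =
    explore (X ∪ ⁅ b ⁆) (rs (p⊆p∪q _ , b , q⊆p∪q X _ (x∈⁅x⁆ b) , b∉X)) (p⊆p∪q _ u∈X) sound′
    where
    sound′ : Sound (X ∪ ⁅ b ⁆)
    sound′ v v∈ with x∈p∪q⁻ X _ v∈
    ... | inj₁ v∈X = sound v v∈X
    ... | inj₂ v∈b with x∈⁅y⁆⇒x≡y b v∈b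
    ... | refl = x∉p⇒x∈∁p b∉S , proj₂ (sound a a∈X) ◅◅ (ab ◅ ε)

-- With separations as `Q`, a search yields either connectedness throughout or an explicit
-- separation.
all-or-fin : {P : Fin n → Set} {Q : Set} → (∀ i → P i ⊎ Q) → (∀ i → P i) ⊎ Q
all-or-fin {zero}  p = inj₁ λ ()
all-or-fin {suc n} p with p zero | all-or-fin (p ∘ suc)
... | inj₂ q  | _       = inj₂ q
... | inj₁ _  | inj₂ q  = inj₂ q
... | inj₁ p₀ | inj₁ ps = inj₁ λ { zero → p₀ ; (suc i) → ps i }

all-or-subset : {P : Subset n → Set} {Q : Set} → (∀ S → P S ⊎ Q) → (∀ S → P S) ⊎ Q
all-or-subset {zero} p with p []
... | inj₁ p₀ = inj₁ λ { [] → p₀ }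
... | inj₂ q  = inj₂ q
all-or-subset {suc n} p with all-or-subset (p ∘ (true ∷_)) | all-or-subset (p ∘ (false ∷_))
... | inj₂ q  | _       = inj₂ q
... | inj₁ _  | inj₂ q  = inj₂ q
... | inj₁ ps | inj₁ qs = inj₁ λ { (true ∷ S) → ps S ; (false ∷ S) → qs S }

-- Separations of the ends of an edge

record Separation (k : ℕ) (H : Graph (Fin n)) (x y : Fin n) : Set where
  field
    side     : Colouring n
    near-end : side x ≡ near
    far-end  : side y ≡ far
    thin     : #cut side < k
    crossing : ∀ a b → Adj H a b → side a ≡ near → side b ≡ far → a ≡ x × b ≡ y

open Separation

reverse : ∀ {H : Graph (Fin n)} {x y} → Separation k H x y → Separation k H y x
reverse {H = H} F = record
  { side     = flip ∘ side F
  ; near-end = cong flip (far-end F)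
  ; far-end  = cong flip (near-end F)
  ; thin     = ≤-<-trans (#-mono-≤ _ _ (λ i → isCut-flip (side F i))) (thin F)
  ; crossing = λ a b ab an bf →
      let b≡ , a≡ = crossing F b a (Graph.sym H ab) (flip-far _ bf) (flip-near _ an) in a≡ , b≡
  }
  where
  isCut-flip : ∀ s → isCut (flip s) ≡ true → isCut s ≡ true
  isCut-flip cut eq = eq

-- Near in the join means near in both colourings, while far in the join means far in at least one,
-- so the edge crosses that one.
join-crossing : ∀ {H : Graph (Fin n)} {x y x′ y′}
  (F : Separation k H x y) (G : Separation k H x′ y′) → ∀ a b → Adj H a b →
  (side F ⊔ᶜ side G) a ≡ near → (side F ⊔ᶜ side G) b ≡ far →
  (a ≡ x × b ≡ y) ⊎ (a ≡ x′ × b ≡ y′)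
join-crossing F G a b ab an bf with ⊔ˢ-near _ _ an | ⊔ˢ-far (side F b) _ bf
... | Fa , _  | inj₁ Fb = inj₁ (crossing F a b ab Fa Fb)
... | _  , Ga | inj₂ Gb = inj₂ (crossing G a b ab Ga Gb)

-- Here `a` and `b` are cuts around opposite corners, `p` and `q` the given cuts: 2k - 1 ≤ a + b ≤ p
-- + q ≤ 2k - 2.
opposite-cuts-too-small : ∀ {a b p q} → k ≤ a + 1 → k ≤ b → a + b ≤ p + q → p < k → q < k → ⊥
opposite-cuts-too-small {k} {a} {b} {p} {q} k≤a+1 k≤b a+b≤p+q p<k q<k = n≮n (suc (p + q)) (begin-strict
  suc (p + q)   <⟨ ≤-refl ⟩
  suc (suc (p + q)) ≡⟨ cong suc (+-suc p q) ⟨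
  suc p + suc q ≤⟨ +-mono-≤ p<k q<k ⟩
  k + k         ≤⟨ +-mono-≤ k≤a+1 k≤b ⟩
  a + 1 + b     ≡⟨ cong (_+ b) (+-comm a 1) ⟩
  suc (a + b)   ≤⟨ s≤s a+b≤p+q ⟩
  suc (p + q)   ∎)
  where open ≤-Reasoning

-- Lower bounds on cuts from connectivity

module _ {H : Graph (Fin n)} (conn : KConnected k H) where

  -- Were the cut smaller than `k`, a walk from `u` to `v` would avoid it, yet no step leads from
  -- near to far.
  separator-size : (c : Colouring n) → (∀ a b → Adj H a b → c a ≡ near → c b ≢ far) →
                   ∀ u v → c u ≡ near → c v ≡ far → k ≤ #cut c
  separator-size c uncrossed u v cu cv = ≮⇒≥ λ small →
    walk (proj₂ conn S small (u , ∉S u (λ eq → case trans (sym cu) eq of λ ()))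
                             (v , ∉S v (λ eq → case trans (sym cv) eq of λ ()))) cu cv
    where
    S : Subset n
    S = tabulate (isCut ∘ c)

    ∉S : ∀ i → c i ≢ cut → i ∈ ∁ S
    ∉S i ci = x∉p⇒x∈∁p λ i∈S →
      ci (isCut-true _ (trans (sym (lookup∘tabulate (isCut ∘ c) i)) ([]=⇒lookup i∈S)))

    walk : ∀ {a b} → Star (Adj (H ─ᵛ S)) a b → c (proj₁ a) ≡ near → c (proj₁ b) ≢ far
    walk ε ca cb = case trans (sym ca) cb of λ ()
    walk {a} (_◅_ {j = m , m∈∁S} am mb) ca cb with c m in cm
    ... | near = walk mb cm cb
    ... | far  = uncrossed _ m am ca cm
    ... | cut  = x∈∁p⇒x∉p m∈∁S
      (lookup⇒[]= m S (trans (lookup∘tabulate (isCut ∘ c) m) (cong isCut cm)))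

  -- Moving u into the cut closes all exits, so k ≤ #cut c + 1 unless u is the
  -- only near vertex; then its degree bounds the cut.
  one-exit-size : (c : Colouring n) (u p q : Fin n) →
    (∀ a b → Adj H a b → c a ≡ near → c b ≡ far → a ≡ u × (b ≡ p ⊎ b ≡ q)) →
    k < degree H u → ∀ w → c w ≡ near → ∀ v → v ≢ u → c v ≡ far → k ≤ #cut c + 1
  one-exit-size c u p q exits k<deg w cw v v≢u cv with k ≤? #cut c + 1
  ... | yes le = le
  ... | no  k≰ = +-cancelʳ-≤ 1 k _ (begin
    k + 1                                             ≡⟨ +-comm k 1 ⟩
    suc k                                             ≤⟨ k<deg ⟩
    degree H u                                        ≤⟨ #-mono-≤ _ _ neighbour ⟩
    # (λ i → (isCut (c i) ∨ only p i) ∨ only q i)     ≤⟨ #-∨-only _ q ⟩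
    # (λ i → isCut (c i) ∨ only p i) + 1              ≤⟨ +-monoˡ-≤ 1 (#-∨-only _ p) ⟩
    #cut c + 1 + 1                                    ∎)
    where
    open ≤-Reasoning

    c′ : Colouring n
    c′ i = if only u i then cut else c i

    c′-≢ : ∀ {i} → i ≢ u → c′ i ≡ c i
    c′-≢ {i} i≢u with only u i in eq
    ... | true  = contradiction (only-true eq) i≢u
    ... | false = refl

    c′-cases : ∀ {i s} → c′ i ≡ s → s ≢ cut → i ≢ u × c i ≡ s
    c′-cases {i} eq s≢cut with only u i in ui
    ... | true  = contradiction (sym eq) s≢cut
    ... | false = (λ { refl → case trans (sym ui) (only-refl u) of λ () }) , eq

    cut-c′ : ∀ i → isCut (c′ i) ≡ true → isCut (c i) ∨ only u i ≡ true
    cut-c′ i eq with only u i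
    ... | true  = ∨-introʳ (isCut (c i)) refl
    ... | false = ∨-introˡ false eq

    near⇒u : ∀ i → c i ≡ near → i ≡ u
    near⇒u i ci with i ≟ u
    ... | yes i≡u = i≡u
    ... | no  i≢u = contradiction
      (≤-trans (separator-size c′ uncrossed i v (trans (c′-≢ i≢u) ci) (trans (c′-≢ v≢u) cv))
        (≤-trans (#-mono-≤ _ _ cut-c′) (#-∨-only _ u)))
      k≰
      where
      uncrossed : ∀ a b → Adj H a b → c′ a ≡ near → c′ b ≢ far
      uncrossed a b ab ca cb =
        let a≢u , ca′ = c′-cases ca λ ()
            _   , cb′ = c′-cases cb λ ()
        in a≢u (proj₁ (exits a b ab ca′ cb′))

    cu : c u ≡ near
    cu = subst (λ i → c i ≡ near) (near⇒u w cw) cw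

    neighbour : ∀ i → does (adj? H u i) ≡ true → (isCut (c i) ∨ only p i) ∨ only q i ≡ true
    neighbour i eq with does-true (adj? H u i) eq | c i in ci
    ... | ui | near = contradiction ui (Graph.irrefl H (sym (near⇒u i ci)))
    ... | ui | cut  = refl
    ... | ui | far with exits u i ui cu ci
    ... | _ , inj₁ refl = ∨-introˡ (only q i) (only-refl i)
    ... | _ , inj₂ refl = ∨-introʳ (only p i) (only-refl i)

  -- A removable edge or a separation of its ends

  module _ {x y : Fin n} (xy : Adj H x y) where

    private
      e : Edge H
      e = edge x y xy

    -- Colour `S` as cut, the set `X` reachable from `u` as near, the rest as far. As `X` is closed
    -- in H - xy - S, only xy can lead from near to far in `H`.
    joined-or-separated : ∀ S → ∣ S ∣ < k → ∀ u v →
                          Star (Adj (H ─ᵉ e ─ᵛ S)) u v ⊎ Separation k H x y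
    joined-or-separated S small u (v , v∈∁S) with reachable (H ─ᵉ e) S u
    ... | X , u∈X , sound , closed with v ∈? X
    ... | yes v∈X = let p , walk = sound v v∈X in
      inj₁ (subst (λ p → Star _ u (v , p)) ([]=-irrelevant p v∈∁S) walk)
    ... | no v∉X = inj₂ separation
      where
      c : Colouring n
      c i = if lookup S i then cut else if lookup X i then near else far

      c-near : ∀ {i} → c i ≡ near → i ∈ X
      c-near {i} eq with lookup S i | lookup X i in iX
      ... | false | true = lookup⇒[]= i X iX

      c-far : ∀ {i} → c i ≡ far → i ∉ S × i ∉ X
      c-far {i} eq with lookup S i in iS | lookup X i in iX
      ... | false | false = ∉-lookup iS , ∉-lookup iX

      near-c : ∀ {i} → i ∈ X → c i ≡ near
      near-c {i} i∈X with lookup S i in iS | lookup X i in iX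
      ... | true  | _     = contradiction (lookup⇒[]= i S iS) (x∈∁p⇒x∉p (proj₁ (sound i i∈X)))
      ... | false | true  = refl
      ... | false | false = contradiction i∈X (∉-lookup iX)

      far-c : ∀ {i} → i ∉ S → i ∉ X → c i ≡ far
      far-c {i} i∉S i∉X with lookup S i in iS | lookup X i in iX
      ... | true  | _     = contradiction (lookup⇒[]= i S iS) i∉S
      ... | false | true  = contradiction (lookup⇒[]= i X iX) i∉X
      ... | false | false = refl

      c-cut : ∀ i → isCut (c i) ≡ true → lookup S i ≡ true
      c-cut i eq with lookup S i | lookup X i
      ... | true  | _     = refl
      ... | false | true  = case eq of λ ()
      ... | false | false = case eq of λ ()

      c-thin : #cut c < k
      c-thin = ≤-<-trans (≤-trans (#-mono-≤ _ _ c-cut) (≤-reflexive (#-lookup S))) small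

      leaving : ∀ a b → Adj H a b → c a ≡ near → c b ≡ far → Joins e a b
      leaving a b ab ca cb = decidable-stable
        ((a ≟ x ×-dec b ≟ y) ⊎-dec (a ≟ y ×-dec b ≟ x))
        (λ ¬joins → let b∉S , b∉X = c-far cb in
          b∉X (closed a b (c-near ca) b∉S (ab , ¬joins)))

      separation : Separation k H x y
      separation with any? (λ a → any? (λ b →
        a ∈? X ×-dec ¬? (b ∈? S) ×-dec ¬? (b ∈? X) ×-dec adj? H a b))
      -- If not even xy leaves `X`, the small cut contradicts the connectivity of `H`.
      ... | no uncrossed = contradiction
        (separator-size c
          (λ a b ab ca cb → let b∉S , b∉X = c-far cb in uncrossed (a , b , c-near ca , b∉S , b∉X , ab))
          (proj₁ u) v (near-c u∈X) (far-c (x∈∁p⇒x∉p v∈∁S) v∉X))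
        (<⇒≱ c-thin)
      ... | yes (a , b , a∈X , b∉S , b∉X , ab)
        with leaving a b ab (near-c a∈X) (far-c b∉S b∉X)
      ... | inj₁ (refl , refl) = record
        { side = c ; near-end = near-c a∈X ; far-end = far-c b∉S b∉X ; thin = c-thin
        ; crossing = λ a′ b′ ab′ ca cb → case leaving a′ b′ ab′ ca cb of λ
          { (inj₁ eqs) → eqs
          ; (inj₂ (refl , refl)) → contradiction (c-near ca) b∉X } }
      -- Here xy leaves `X` from `y`, so the colouring separates `y` from `x` and is reversed.
      ... | inj₂ (refl , refl) = reverse record
        { side = c ; near-end = near-c a∈X ; far-end = far-c b∉S b∉X ; thin = c-thin
        ; crossing = λ a′ b′ ab′ ca cb → case leaving a′ b′ ab′ ca cb of λ
          { (inj₂ eqs) → eqs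
          ; (inj₁ (refl , refl)) → contradiction (c-near ca) b∉X } }

    removable-or-separated : Removable k H e ⊎ Separation k H x y
    removable-or-separated with all-or-subset connected-or-separated
      where
      connected-or-separated : ∀ S →
        (∣ S ∣ < k → Connected (H ─ᵉ e ─ᵛ S)) ⊎ Separation k H x y
      connected-or-separated S with ∣ S ∣ <? k
      ... | no  big   = inj₁ λ small → contradiction small big
      ... | yes small with all-or-fin (λ u → all-or-fin (λ v → walks u v))
        where
        Walks : Fin n → Fin n → Set
        Walks u v = ∀ u∈ v∈ → Star (Adj (H ─ᵉ e ─ᵛ S)) (u , u∈) (v , v∈)

        walks : ∀ u v → Walks u v ⊎ Separation k H x y
        walks u v with u ∈? ∁ S | v ∈? ∁ S
        ... | no u∉  | _      = inj₁ λ u∈ _ → contradiction u∈ u∉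
        ... | yes _  | no v∉  = inj₁ λ _ v∈ → contradiction v∈ v∉
        ... | yes u∈ | yes v∈ with joined-or-separated S small (u , u∈) (v , v∈)
        ... | inj₂ sep  = inj₂ sep
        ... | inj₁ walk = inj₁ λ u∈′ v∈′ →
          subst₂ (λ p q → Star _ (u , p) (v , q)) ([]=-irrelevant u∈ u∈′) ([]=-irrelevant v∈ v∈′) walk
      ... | inj₁ walks = inj₁ λ _ (u , u∈) (v , v∈) → walks u v u∈ v∈
      ... | inj₂ sep   = inj₂ sep
    ... | inj₁ connected = inj₁ (proj₁ conn , connected)
    ... | inj₂ sep       = inj₂ sep

  -- Uncrossing two separations at a common vertex

  module _ {x y z : Fin n} (F : Separation k H x y) (G : Separation k H x z)
           (xy : Adj H x y) (xz : Adj H x z) (z≢y : z ≢ y) (k<deg-x : k < degree H x) where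

    private
      c d : Colouring n
      c = side F
      d = side G

      y-not-far : d y ≢ far
      y-not-far dy = z≢y (sym (proj₂ (crossing G x y xy (near-end G) dy)))

      z-not-far : c z ≢ far
      z-not-far cz = z≢y (proj₂ (crossing F x z xz (near-end F) cz))

    -- Only xy and xz can leave the corner near ∩ near, and both start at `x`.
    near-near-cut : k ≤ #cut (c ⊔ᶜ d) + 1
    near-near-cut = one-exit-size (c ⊔ᶜ d) x y z
      (λ a b ab an bf → case join-crossing F G a b ab an bf of λ
        { (inj₁ (a≡x , b≡y)) → a≡x , inj₁ b≡y
        ; (inj₂ (a≡x , b≡z)) → a≡x , inj₂ b≡z })
      k<deg-x x (cong₂ _⊔ˢ_ (near-end F) (near-end G))
      y (λ { refl → Graph.irrefl H refl xy }) (cong (_⊔ˢ d y) (far-end F))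

    -- An edge leaving this corner would be yx or zx, but `y` is not far in `d` and `z` is not far
    -- in `c`. A nonempty corner would thus need a cut of size `k`, against submodularity.
    far-far-empty : ∀ i → c i ≡ far → d i ≢ far
    far-far-empty i ci di = opposite-cuts-too-small near-near-cut
      (separator-size _ uncrossed i x (cong₂ _⊔ˢ_ (cong flip ci) (cong flip di))
        (cong (_⊔ˢ flip (d x)) (cong flip (near-end F))))
      (cut-submodular c d) (thin F) (thin G)
      where
      uncrossed : ∀ a b → Adj H a b → ((flip ∘ c) ⊔ᶜ (flip ∘ d)) a ≡ near →
                  ((flip ∘ c) ⊔ᶜ (flip ∘ d)) b ≢ far
      uncrossed a b ab an bf with join-crossing (reverse F) (reverse G) a b ab an bf
      ... | inj₁ (refl , _) = y-not-far (flip-near _ (proj₂ (⊔ˢ-near (flip (c a)) _ an)))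
      ... | inj₂ (refl , _) = z-not-far (flip-near _ (proj₁ (⊔ˢ-near (flip (c a)) _ an)))

    far-smaller : #near (flip ∘ d) < #near c
    -- Since `suc (#cut c) ≤ k ≤ #cut (c ⊔ᶜ d) + 1`, the term `#cut c` cancels.
    far-smaller = +-cancelʳ-< (#cut c) _ _ (≤-<-trans
      (+-monoʳ-≤ (#near (flip ∘ d)) (≤-pred
        (subst (suc (#cut c) ≤_) (+-comm _ 1) (≤-trans (thin F) near-near-cut))))
      (far+join<near+cut c d far-far-empty x (near-end F) (near-end G)))

    -- By submodularity, a thick cut around near ∩ far forces far ∩ near to be empty. Counting then
    -- compares the near sides, and `thin F` makes the inequality strict.
    near-smaller : k < degree H y → k ≤ #cut (c ⊔ᶜ (flip ∘ d)) → #near d < #near c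
    near-smaller k<deg-y k≤cut = +-cancelʳ-< (#cut c) _ _ (<-≤-trans
      (+-monoʳ-< (#near d) (<-≤-trans (thin F) k≤cut))
      (near+join≤near+cut c d far-near-empty))
      where
      exits : ∀ a b → Adj H a b → ((flip ∘ c) ⊔ᶜ d) a ≡ near → ((flip ∘ c) ⊔ᶜ d) b ≡ far →
              a ≡ y × (b ≡ x ⊎ b ≡ x)
      exits a b ab an bf with join-crossing (reverse F) G a b ab an bf
      ... | inj₁ (a≡y , b≡x) = a≡y , inj₁ b≡x
      ... | inj₂ (refl , _)  = case
        trans (sym (cong flip (near-end F))) (proj₁ (⊔ˢ-near (flip (c a)) _ an)) of λ ()

      far-near-empty : ∀ i → c i ≡ far → d i ≢ near
      far-near-empty i ci di = opposite-cuts-too-small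
        -- Only yx can leave this corner, so both permitted far ends are `x`.
        (one-exit-size ((flip ∘ c) ⊔ᶜ d) y x x exits k<deg-y
          i (cong₂ _⊔ˢ_ (cong flip ci) di)
          x (λ { refl → Graph.irrefl H refl xy }) (cong (_⊔ˢ d x) (cong flip (near-end F))))
        k≤cut
        (≤-trans (≤-reflexive (+-comm (#cut ((flip ∘ c) ⊔ᶜ d)) _)) (cut-submodular′ c d))
        (thin F) (thin G)

    -- The edge xy cannot leave this corner, since `x` is near in `d`; only zx remains.
    near-far-separation : c z ≡ near → #cut (c ⊔ᶜ (flip ∘ d)) < k → Separation k H z x
    near-far-separation cz small = record
      { side     = c ⊔ᶜ (flip ∘ d)
      ; near-end = cong₂ _⊔ˢ_ cz (cong flip (far-end G))
      ; far-end  = ⊔ˢ-farʳ (c x) (cong flip (near-end G))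
      ; thin     = small
      ; crossing = exits
      }
      where
      exits : ∀ a b → Adj H a b → (c ⊔ᶜ (flip ∘ d)) a ≡ near → (c ⊔ᶜ (flip ∘ d)) b ≡ far →
              a ≡ z × b ≡ x
      exits a b ab an bf with join-crossing F (reverse G) a b ab an bf
      ... | inj₂ eqs = eqs
      ... | inj₁ (refl , _) = case
        trans (sym (cong flip (near-end G))) (proj₂ (⊔ˢ-near (c a) _ an)) of λ ()

  -- Descent to a removable edge

  module _ (W : Subset n) (k<deg : ∀ x → x ∉ W → k < degree H x) where

    private
      Goal : Set
      Goal = ∃ λ (e : Edge H) → end₁ e ∉ W × end₂ e ∉ W × Removable k H e

    -- The next edge is zx with `reverse G`, whose near side is the far side of `G`. Finding `z`
    -- outside `W` and distinct from `y` takes a degree above |W| + 1.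
    descend-past-W : (∀ x → x ∉ W → ∣ W ∣ + 1 < degree H x) →
      ∀ {x y} → x ∉ W → y ∉ W → Adj H x y → (F : Separation k H x y) →
      Acc _<_ (#near (side F)) → Goal
    descend-past-W large {x} {y} x∉W y∉W xy F (acc smaller)
      with #-< (λ i → lookup W i ∨ only y i) (does ∘ adj? H x)
             (≤-<-trans (#-∨-only (lookup W) y)
               (subst (λ w → w + 1 < degree H x) (sym (#-lookup W)) (large x x∉W)))
    ... | z , xz? , z∉ with does-true (adj? H x z) xz? | ∨-false (lookup W z) z∉
    ... | xz | Wz , yz with removable-or-separated xz
    ... | inj₁ removable = edge x z xz , x∉W , ∉-lookup Wz , removable
    ... | inj₂ G = descend-past-W large (∉-lookup Wz) x∉W (Graph.sym H xz) (reverse G)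
      (smaller (far-smaller F G xy xz (only-≢ yz) (k<deg x x∉W)))

    -- Having fewer than `t` vertices of `W` near guarantees a neighbour `z` of `x` that is near and
    -- outside `W`. As |W| < 2t, at least one side of `G` has this property again.
    descend-inside : ∀ t → ∣ W ∣ < t + t → (∀ x → x ∉ W → k + t ≤ degree H x) →
      ∀ {x y} → x ∉ W → y ∉ W → Adj H x y → (F : Separation k H x y) →
      nearW W (side F) < t → Acc _<_ (#near (side F)) → Goal
    descend-inside t W<2t large {x} {y} x∉W y∉W xy F few (acc smaller) with
      #-< (λ i → (isCut (side F i) ∨ (isNear (side F i) ∧ lookup W i)) ∨ only y i)
          (does ∘ adj? H x) count
      where
      open ≤-Reasoning
      count : # (λ i → (isCut (side F i) ∨ (isNear (side F i) ∧ lookup W i)) ∨ only y i) < degree H x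
      -- At most (k - 1) + (t - 1) + 1 vertices are excluded.
      count = begin-strict
        # (λ i → (isCut (side F i) ∨ (isNear (side F i) ∧ lookup W i)) ∨ only y i)
          ≤⟨ #-∨-only _ y ⟩
        # (λ i → isCut (side F i) ∨ (isNear (side F i) ∧ lookup W i)) + 1
          ≤⟨ +-monoˡ-≤ 1 (#-∨ (isCut ∘ side F) _) ⟩
        #cut (side F) + nearW W (side F) + 1
          ≡⟨ +-comm _ 1 ⟩
        suc (#cut (side F)) + nearW W (side F)
          <⟨ +-mono-≤-< (thin F) few ⟩
        k + t
          ≤⟨ large x x∉W ⟩
        degree H x ∎
    ... | z , xz? , z∉ with does-true (adj? H x z) xz? | ∨-false (isCut (side F z) ∨ _) z∉
    ... | xz | not-c , yz with inside (side F z) refl not-c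
      where
      inside : ∀ s → side F z ≡ s → isCut s ∨ (isNear s ∧ lookup W z) ≡ false →
               side F z ≡ near × lookup W z ≡ false
      inside near eq Wz = eq , Wz
      -- A far neighbour of `x` can only be `y`, which is excluded.
      inside far  eq _  =
        contradiction (proj₂ (crossing F x z xz (near-end F) eq)) (only-≢ yz)
    ... | z-near , Wz with removable-or-separated xz
    ... | inj₁ removable = edge x z xz , x∉W , ∉-lookup Wz , removable
    ... | inj₂ G with nearW W (flip ∘ side G) <? t
    ... | yes few′ = descend-inside t W<2t large (∉-lookup Wz) x∉W (Graph.sym H xz) (reverse G) few′
      (smaller (far-smaller F G xy xz (only-≢ yz) (k<deg x x∉W)))
    ... | no many with #cut (side F ⊔ᶜ (flip ∘ side G)) <? k
    -- The corner near ∩ far is the near side of a separation for zx. It lies in the near side of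
    -- `F`, so it inherits the bound on `W`, and it misses `x`.
    ... | yes thin′ = descend-inside t W<2t large (∉-lookup Wz) x∉W (Graph.sym H xz)
      (near-far-separation F G xy xz (only-≢ yz) (k<deg x x∉W) z-near thin′)
      (≤-<-trans (#-mono-≤ _ _ λ i → join-⊆ (side F i) (flip (side G i))) few)
      (smaller (near-join-< (side F) (flip ∘ side G) x (near-end F) (cong flip (near-end G))))
      where
      join-⊆ : ∀ s t {b} → isNear (s ⊔ˢ t) ∧ b ≡ true → isNear s ∧ b ≡ true
      join-⊆ near near eq = eq
      join-⊆ cut  near ()
      join-⊆ cut  cut ()
      join-⊆ cut  far ()
    -- The far side of `G` holds at least `t` vertices of `W`, so the near side holds fewer; the
    -- thick corner cut makes it smaller than that of `F`.
    ... | no thick = descend-inside t W<2t large x∉W (∉-lookup Wz) xz G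
      (≰⇒> λ t≤ → <⇒≱ W<2t (≤-trans (+-mono-≤ (≮⇒≥ many) t≤) (nearW-flip W (side G))))
      (smaller (near-smaller F G xy xz (only-≢ yz) (k<deg x x∉W) (k<deg y y∉W) (≮⇒≥ thick)))

-- Arithmetic of the degree bound, and the conclusion

w<2⌈w+1/2⌉ : ∀ w → w < ⌈ w + 1 / 2 ⌉ + ⌈ w + 1 / 2 ⌉
w<2⌈w+1/2⌉ w = ≤-pred (begin
  suc (suc w)                 ≡⟨ +-comm 2 w ⟩
  w + 2                       ≡⟨ +-assoc w 1 1 ⟨
  -- The ceiling unfolds to `(w + 1 + 1) / 2`, with remainder at most 1.
  w + 1 + 1                   ≡⟨ m≡m%n+[m/n]*n (w + 1 + 1) 2 ⟩
  (w + 1 + 1) % 2 + t * 2     ≤⟨ +-monoˡ-≤ (t * 2) (≤-pred (m%n<n (w + 1 + 1) 2)) ⟩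
  1 + t * 2                   ≡⟨ cong suc (*-comm t 2) ⟩
  1 + (t + (t + 0))           ≡⟨ cong (λ m → suc (t + m)) (+-identityʳ t) ⟩
  suc (t + t)                 ∎)
  where
  open ≤-Reasoning
  t = ⌈ w + 1 / 2 ⌉

k<h : ∀ k w → k < h k w
k<h k w = begin-strict
  -- The ceiling is at least 1 because its numerator w + 1 + 3 is at least 4.
  k                     <⟨ m<m+n k (/-monoˡ-≤ 4 (subst (4 ≤_) (sym (+-assoc w 1 3)) (m≤n+m 4 w))) ⟩
  k + ⌈ w + 1 / 4 ⌉     ≤⟨ m≤m⊔n _ _ ⟩
  h k w                 ∎
  where open ≤-Reasoning

theorem3p1 : ∀ (n k : ℕ) → 1 ≤ k →
    (H : Graph (Fin n)) → KConnected k H →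
    (W : Subset n) →
    Edge (H ─ᵛ W) →
    (∀ x → x ∉ W → h k ∣ W ∣ ≤ degree H x) →
    ∃ λ (e : Edge H) → end₁ e ∉ W × end₂ e ∉ W × Removable k H e
theorem3p1 n k _ H conn W (edge (x , x∈) (y , y∈) xy) h≤deg with removable-or-separated conn xy
... | inj₁ removable = edge x y xy , x∈∁p⇒x∉p x∈ , x∈∁p⇒x∉p y∈ , removable
-- Whichever argument attains the minimum in `h` selects the descent.
... | inj₂ F = conclude (⊓-sel (k + t) (∣ W ∣ + 2))
  where
  t : ℕ
  t = ⌈ ∣ W ∣ + 1 / 2 ⌉

  x∉W : x ∉ W
  x∉W = x∈∁p⇒x∉p x∈

  y∉W : y ∉ W
  y∉W = x∈∁p⇒x∉p y∈

  k<deg : ∀ x → x ∉ W → k < degree H x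
  k<deg x x∉W = <-≤-trans (k<h k ∣ W ∣) (h≤deg x x∉W)

  min≤deg : ∀ x → x ∉ W → (k + t) ⊓ (∣ W ∣ + 2) ≤ degree H x
  min≤deg x x∉W = ≤-trans (m≤n⊔m (k + ⌈ ∣ W ∣ + 1 / 4 ⌉) _) (h≤deg x x∉W)

  conclude : (k + t) ⊓ (∣ W ∣ + 2) ≡ k + t ⊎ (k + t) ⊓ (∣ W ∣ + 2) ≡ ∣ W ∣ + 2 →
             ∃ λ (e : Edge H) → end₁ e ∉ W × end₂ e ∉ W × Removable k H e
  conclude (inj₂ eq) = descend-past-W conn W k<deg
    (λ x x∉W → subst (_≤ degree H x) (trans eq (+-suc ∣ W ∣ 1)) (min≤deg x x∉W))
    x∉W y∉W xy F (<-wellFounded _)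
  conclude (inj₁ eq) with nearW W (side F) <? t
  ... | yes few = descend-inside conn W k<deg t (w<2⌈w+1/2⌉ ∣ W ∣)
    (λ x x∉W → subst (_≤ degree H x) eq (min≤deg x x∉W)) x∉W y∉W xy F few (<-wellFounded _)
  -- With at least `t` vertices of `W` near, fewer than `t` are far, so the descent starts from `y`.
  ... | no many = descend-inside conn W k<deg t (w<2⌈w+1/2⌉ ∣ W ∣)
    (λ x x∉W → subst (_≤ degree H x) eq (min≤deg x x∉W)) y∉W x∉W (Graph.sym H xy) (reverse F)
    (≰⇒> λ t≤ → <⇒≱ (w<2⌈w+1/2⌉ ∣ W ∣)
      (≤-trans (+-mono-≤ t≤ (≮⇒≥ many)) (nearW-flip W (side F))))
    (<-wellFounded _)
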